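{- Let $k$ be a positive integer and let $E(x,k)=\sum_{n=0}^{\infty}M_n^{(k)}\frac{x^n}{n!}$ be the exponential generating function of the higher order Mersenne numbers. Then $$E(x,k)=\frac{e^{2^kx}-e^{x}}{2^k-1} .$$
   Context: The Mersenne numbers $\{M_n\}_{n\ge 0}$ are defined by $M_0=0$, $M_1=1$, $M_{n+2}=3M_{n+1}-2M_n$, i.e. $M_n=2^n-1$. For a positive integer $k$, the higher order Mersenne numbers are $M_n^{(k)}=M_{kn}/M_k$ for $n=0,1,2,\dots$. -}

module Defs where

open import Data.Nat.Base as ℕ using (ℕ; zero; suc; _!)
open import Data.Nat.Properties as ℕ using (_!≢0)
open import Data.Integer.Base as ℤ using (ℤ; +_; 0ℤ; 1ℤ)
import Data.Integer.Properties as ℤ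
open import Data.Integer.Tactic.RingSolver using (solve-∀)
open import Data.Rational.Base as ℚ using (ℚ; 1ℚ; _÷_)
open import Data.Rational.Literals using (fromℤ)
open import Data.Rational.Properties using (+-*-rawRing)
open import Algebra.Bundles.Raw using (module RawRing)
open import Algebra.Definitions.RawSemiring (RawRing.rawSemiring +-*-rawRing) using (_^_)
open import Relation.Binary.PropositionalEquality

M : ℕ → ℤ
M zero          = 0ℤ
M (suc zero)    = 1ℤ
M (suc (suc n)) = + 3 ℤ.* M (suc n) ℤ.- + 2 ℤ.* M n

M≡2^n-1 : ∀ n → M n ≡ (+ 2) ℤ.^ n ℤ.- 1ℤ
M≡2^n-1 zero          = refl
M≡2^n-1 (suc zero)    = refl
M≡2^n-1 (suc (suc n)) = begin
  + 3 ℤ.* M (suc n) ℤ.- + 2 ℤ.* M n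
    ≡⟨ cong₂ (λ a b → + 3 ℤ.* a ℤ.- + 2 ℤ.* b) (M≡2^n-1 (suc n)) (M≡2^n-1 n) ⟩
  + 3 ℤ.* ((+ 2) ℤ.^ suc n ℤ.- 1ℤ) ℤ.- + 2 ℤ.* ((+ 2) ℤ.^ n ℤ.- 1ℤ)
    ≡⟨ step ((+ 2) ℤ.^ n) ⟩
  (+ 2) ℤ.^ suc (suc n) ℤ.- 1ℤ ∎
  where
  open ≡-Reasoning
  step : ∀ p → + 3 ℤ.* (+ 2 ℤ.* p ℤ.- 1ℤ) ℤ.- + 2 ℤ.* (p ℤ.- 1ℤ)
             ≡ + 2 ℤ.* (+ 2 ℤ.* p) ℤ.- 1ℤ
  step = solve-∀

2^k≢1 : ∀ k .{{_ : ℕ.NonZero k}} → (+ 2) ℤ.^ k ≢ 1ℤ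
2^k≢1 (suc k) eq = ℕ.even≢odd ℤ.∣ (+ 2) ℤ.^ k ∣ 0
  (trans (sym (ℤ.abs-* (+ 2) ((+ 2) ℤ.^ k))) (cong ℤ.∣_∣ eq))

2^k-1≢0 : ∀ k .{{_ : ℕ.NonZero k}} → ℤ.NonZero ((+ 2) ℤ.^ k ℤ.- 1ℤ)
2^k-1≢0 k = ℤ.≢-nonZero (λ eq → 2^k≢1 k (ℤ.i-j≡0⇒i≡j _ 1ℤ eq))

M≢0 : ∀ k .{{_ : ℕ.NonZero k}} → ℤ.NonZero (M k)
M≢0 k = subst ℤ.NonZero (sym (M≡2^n-1 k)) (2^k-1≢0 k)

-- The quotient is taken in ℚ, so no divisibility is built into the definition.
M⟨_⟩ : (k : ℕ) .{{_ : ℕ.NonZero k}} → ℕ → ℚ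
M⟨ k ⟩ n = (fromℤ (M (k ℕ.* n)) ÷ fromℤ (M k)) {{M≢0 k}}

-- Formal power series over ℚ in one variable x: f n is the coefficient of xⁿ.
PowerSeries : Set
PowerSeries = ℕ → ℚ

infix  4 _≈_
infixl 6 _⊖_
infixl 7 _⊘_

_≈_ : PowerSeries → PowerSeries → Set
f ≈ g = ∀ n → f n ≡ g n

_⊖_ : PowerSeries → PowerSeries → PowerSeries
(f ⊖ g) n = f n ℚ.- g n

_⊘_ : PowerSeries → (c : ℚ) .{{_ : ℚ.NonZero c}} → PowerSeries
(f ⊘ c) n = f n ÷ c

-- ∑ aₙ xⁿ / n!
egf : (ℕ → ℚ) → PowerSeries
egf a n = (a n ÷ fromℤ (+ (n !))) {{n !≢0}}

-- eˣ = ∑ xⁿ / n!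
exp : PowerSeries
exp = egf (λ _ → 1ℚ)

-- The substitution x ↦ c x, i.e. f(c x) = ∑ fₙ cⁿ xⁿ.
_[_·x] : PowerSeries → ℚ → PowerSeries
(f [ c ·x]) n = f n ℚ.* c ^ n

E : (k : ℕ) .{{_ : ℕ.NonZero k}} → PowerSeries
E k = egf M⟨ k ⟩

{-# OPTIONS --safe #-}
-- Since M (k n) = (2^k)ⁿ - 1 and M k = 2^k - 1, both sides have xⁿ-coefficient
-- ((2^k)ⁿ - 1) / ((2^k - 1) n!).
module Submission where

open import Defs
open import Data.Nat.Base as ℕ using (ℕ; NonZero; zero; suc; _!)
open import Data.Nat.Properties using (_!≢0)
open import Data.Integer.Base as ℤ using (+_; _^_; _-_; 1ℤ; +0; +[1+_]; -[1+_])
import Data.Integer.Properties as ℤ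
open import Data.Rational.Base as ℚ using (ℚ; 1ℚ; 1/_; _÷_; _/_)
open import Data.Rational.Literals using (fromℤ)
open import Data.Rational.Properties using (fromℚᵘ-toℚᵘ; +-*-rawRing)
open import Data.Rational.Solver using (module +-*-Solver)
open import Algebra.Bundles.Raw using (module RawRing)
open import Algebra.Definitions.RawSemiring (RawRing.rawSemiring +-*-rawRing)
  using () renaming (_^_ to _^ℚ_)
open import Relation.Binary.PropositionalEquality

-- Series are compared coefficientwise. As 2^(kn) = (2^k)^n, the quotient M(kn)/M(k) is a difference
-- of two geometric terms, (2^k)^n and 1, over the constant 2^k - 1; dividing these by n! gives the
-- coefficients of e^(2^k x) and e^x. `M` lives in ℤ and the series in ℚ, so the closed form is
-- carried across by `fromℤ` being a ring homomorphism (`fromℤ-M-*`).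

fromℤ-homo-+ : ∀ i j → fromℤ (i ℤ.+ j) ≡ fromℤ i ℚ.+ fromℤ j
fromℤ-homo-+ i j = begin
  fromℤ (i ℤ.+ j)                    ≡⟨ fromℚᵘ-toℚᵘ (fromℤ (i ℤ.+ j)) ⟨
  -- The factors 1 are the denominators that cross-multiplication in ℚ introduces.
  (i ℤ.+ j) / 1                      ≡⟨ cong (_/ 1) (cong₂ ℤ._+_ (ℤ.*-identityʳ i) (ℤ.*-identityʳ j)) ⟨
  (i ℤ.* + 1 ℤ.+ j ℤ.* + 1) / 1      ≡⟨⟩
  fromℤ i ℚ.+ fromℤ j                ∎
  where open ≡-Reasoning

fromℤ-homo-* : ∀ i j → fromℤ (i ℤ.* j) ≡ fromℤ i ℚ.* fromℤ j
fromℤ-homo-* i j = sym (fromℚᵘ-toℚᵘ (fromℤ (i ℤ.* j)))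

-- The case split is needed because negation on ℚ matches on the sign of the numerator.
fromℤ-homo-neg : ∀ i → fromℤ (ℤ.- i) ≡ ℚ.- fromℤ i
fromℤ-homo-neg +0       = refl
fromℤ-homo-neg +[1+ _ ] = refl
fromℤ-homo-neg -[1+ _ ] = refl

fromℤ-homo-- : ∀ i j → fromℤ (i - j) ≡ fromℤ i ℚ.- fromℤ j
fromℤ-homo-- i j = trans (fromℤ-homo-+ i (ℤ.- j)) (cong (fromℤ i ℚ.+_) (fromℤ-homo-neg j))

fromℤ-homo-^ : ∀ i n → fromℤ (i ^ n) ≡ fromℤ i ^ℚ n
fromℤ-homo-^ i zero    = refl
fromℤ-homo-^ i (suc n) =
  trans (fromℤ-homo-* i (i ^ n)) (cong (fromℤ i ℚ.*_) (fromℤ-homo-^ i n))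

-- Plain `cong` cannot change a divisor on which the nonzero evidence depends; that evidence is
-- irrelevant, so `refl` suffices once the operands agree.
÷-cong : ∀ {p q r s} .{{_ : ℚ.NonZero q}} .{{_ : ℚ.NonZero s}} →
         p ≡ r → q ≡ s → p ÷ q ≡ r ÷ s
÷-cong refl refl = refl

fromℤ-M-* : ∀ k n → fromℤ (M (k ℕ.* n)) ≡ fromℤ ((+ 2) ^ k) ^ℚ n ℚ.- 1ℚ
fromℤ-M-* k n = begin
  fromℤ (M (k ℕ.* n))                ≡⟨ cong fromℤ (M≡2^n-1 (k ℕ.* n)) ⟩
  fromℤ ((+ 2) ^ (k ℕ.* n) - 1ℤ)     ≡⟨ cong (λ p → fromℤ (p - 1ℤ)) (ℤ.^-*-assoc (+ 2) k n) ⟨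
  fromℤ (((+ 2) ^ k) ^ n - 1ℤ)       ≡⟨ fromℤ-homo-- (((+ 2) ^ k) ^ n) 1ℤ ⟩
  fromℤ (((+ 2) ^ k) ^ n) ℚ.- 1ℚ     ≡⟨ cong (ℚ._- 1ℚ) (fromℤ-homo-^ ((+ 2) ^ k) n) ⟩
  fromℤ ((+ 2) ^ k) ^ℚ n ℚ.- 1ℚ      ∎
  where open ≡-Reasoning

-- The inverses of 2^k - 1 and n! enter as the atoms `u` and `v`, so no field reasoning is needed;
-- `1ℚ ℚ.* v` is the coefficient of `exp` unfolded.
[p-1]*u*v≡[1*v*p-1*v]*u : ∀ p u v → (p ℚ.- 1ℚ) ℚ.* u ℚ.* v ≡ (1ℚ ℚ.* v ℚ.* p ℚ.- 1ℚ ℚ.* v) ℚ.* u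
[p-1]*u*v≡[1*v*p-1*v]*u = solve 3
  (λ p u v → (p :- con 1ℚ) :* u :* v := (con 1ℚ :* v :* p :- con 1ℚ :* v) :* u) refl
  where open +-*-Solver

theorem2p14 : (k : ℕ) .{{_ : NonZero k}} →
    E k ≈ ((exp [ fromℤ ((+ 2) ^ k) ·x] ⊖ exp) ⊘ fromℤ ((+ 2) ^ k - 1ℤ)) {{2^k-1≢0 k}}
theorem2p14 k n = begin
  -- Both ends of the chain are the n-th coefficients by definition, `÷` being multiplication by the
  -- inverse.
  M⟨ k ⟩ n ℚ.* 1/n!
    ≡⟨ cong (ℚ._* 1/n!)
         (÷-cong {{M≢0 k}} {{2^k-1≢0 k}} (fromℤ-M-* k n) (cong fromℤ (M≡2^n-1 k))) ⟩
  (P ℚ.- 1ℚ) ℚ.* 1/c ℚ.* 1/n!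
    ≡⟨ [p-1]*u*v≡[1*v*p-1*v]*u P 1/c 1/n! ⟩
  (1ℚ ℚ.* 1/n! ℚ.* P ℚ.- 1ℚ ℚ.* 1/n!) ℚ.* 1/c
    ∎
  where
  open ≡-Reasoning
  P 1/c 1/n! : ℚ
  P    = fromℤ ((+ 2) ^ k) ^ℚ n
  1/c  = (1/ fromℤ ((+ 2) ^ k - 1ℤ)) {{2^k-1≢0 k}}
  1/n! = (1/ fromℤ (+ (n !))) {{n !≢0}}
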